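{- Let $k<n/2$. Every $k$-sparse symmetric function $f:\{0,1\}^n\to\{0,1\}$ can be represented as an exact majority of $n^{O(k)}$ ANDs, each on at most $k$ of the inputs $x_1,\dots,x_n$.
   Context: A symmetric function $f:\{0,1\}^n\to\{0,1\}$ has a companion function $g:\{0,1,\dots,n\}\to\{0,1\}$ with $f(x)=g(\sum_i x_i)$; $f$ is $k$-sparse if $|g^{ -1}(1)|=k$. The exact majority gate $\mathrm{EMAJ}(y_1,\dots,y_t,u)$ outputs $1$ iff exactly $u$ of the $y_i$ equal $1$.
   Formalization: The ANDs may take negated inputs as well as inputs (conjunctions of at most k literals); with unnegated inputs only the claim fails, e.g. for n = 5, k = 2 and f equal to 1 exactly on the all-zeros and all-ones inputs. -}

module Defs where

open import Data.Bool using (Bool; true; not; _≟_)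
open import Data.Fin using (Fin; fromℕ<)
open import Data.List using (List; and; length; map)
open import Data.Nat using (ℕ; suc; _≤_; s≤s)
import Data.Nat as ℕ
open import Data.Product using (Σ-syntax; ∃-syntax; _×_; _,_)
open import Data.Vec using (Vec; count; lookup; tabulate)
import Data.Vec as Vec
open import Data.Vec.Properties using (count≤n)
open import Data.Vec.Relation.Unary.All using (All)
open import Relation.Binary.PropositionalEquality using (_≡_)
open import Relation.Nullary.Decidable using (⌊_⌋)

BoolFun : ℕ → Set
BoolFun n = Vec Bool n → Bool

#ones : ∀ {n} → Vec Bool n → ℕ
#ones = count (_≟ true)

weight : ∀ {n} → Vec Bool n → Fin (suc n)
weight x = fromℕ< (s≤s (count≤n (_≟ true) x))

IsCompanion : ∀ {n} → (Fin (suc n) → Bool) → BoolFun n → Set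
IsCompanion g f = ∀ x → f x ≡ g (weight x)

Symmetric : ∀ {n} → BoolFun n → Set
Symmetric {n} f = Σ[ g ∈ (Fin (suc n) → Bool) ] IsCompanion g f

-- The companion of f is unique, so it does not matter that this quantifies
-- over it existentially.
SparseSymmetric : ∀ {n} → ℕ → BoolFun n → Set
SparseSymmetric k f = Σ[ (g , _) ∈ Symmetric f ] #ones (tabulate g) ≡ k

EMAJ : ∀ {t} → Vec Bool t → ℕ → Bool
EMAJ ys u = ⌊ #ones ys ℕ.≟ u ⌋

-- Negated inputs are needed: an exact majority of ANDs of unnegated inputs
-- takes the value 1 on an interval of any chain of inputs, so it cannot, for
-- instance, be 1 exactly on the all-zeros and the all-ones input.
data Literal (n : ℕ) : Set where
  pos neg : Fin n → Literal n

evalLiteral : ∀ {n} → Literal n → BoolFun n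
evalLiteral (pos i) x = lookup x i
evalLiteral (neg i) x = not (lookup x i)

-- The empty list is the AND of no inputs, i.e. the constant 1.
ANDGate : ℕ → Set
ANDGate n = List (Literal n)

evalAND : ∀ {n} → ANDGate n → BoolFun n
evalAND G x = and (map (λ l → evalLiteral l x) G)

fanIn : ∀ {n} → ANDGate n → ℕ
fanIn = length

-- f is an exact majority of at most s ANDs, each on at most k inputs. The gates
-- need not be distinct.
EMAJofANDs : ∀ {n} → (s k : ℕ) → BoolFun n → Set
EMAJofANDs {n} s k f =
  ∃[ t ] t ≤ s ×
  Σ[ Gs ∈ Vec (ANDGate n) t ] All (λ G → fanIn G ≤ k) Gs ×
  ∃[ u ] ∀ x → f x ≡ EMAJ (Vec.map (λ G → evalAND G x) Gs) u

{-# OPTIONS --safe #-}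
module Submission where

-- Write s for the number of ones of the input and S for the set of accepted
-- weights. Then f(x) = 1 iff ∏ (s − a) = 0, the product being over a ∈ S.
-- Substituting s = x₁ + … + xₙ and expanding gives a difference P − N of two sums
-- of monomials of degree at most |S| with at most ∏ (n + a) ≤ (2n)^k monomials in
-- total. A negated monomial is, up to the constant 1, a sum of ANDs:
--   1 − x₁⋯xⱼ = (1 − x₁) + x₁(1 − x₂) + ⋯ + x₁⋯xⱼ₋₁(1 − xⱼ),
-- so P = N becomes the condition that exactly |N| ANDs accept.

open import Data.Bool using (Bool; true; false; if_then_else_; _∧_; _≟_)
open import Data.Fin using (Fin; zero; suc; toℕ)
open import Data.Fin.Properties using (toℕ≤pred[n]; toℕ-fromℕ<; toℕ-injective)
open import Data.List as List using (List; []; _∷_; _++_; allFin; concat; concatMap; filter; length; map; replicate)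
open import Data.List.Membership.Propositional using (_∈_)
open import Data.List.Membership.Propositional.Properties using (∈-allFin; ∈-filter⁺; ∈-filter⁻)
open import Data.List.Properties using (length-++; length-map; map-++)
open import Data.List.Relation.Unary.All as All using (All; []; _∷_)
import Data.List.Relation.Unary.All.Properties as All
open import Data.List.Relation.Unary.Any using (here; there)
open import Data.Nat using (ℕ; zero; suc; _+_; _*_; _^_; _≤_; _<_; z≤n; s≤s)
open import Data.Nat.ListAction using (product; sum)
open import Data.Nat.ListAction.Properties using (sum-++)
open import Data.Nat.Properties hiding (_≟_)
open import Data.Nat.Tactic.RingSolver using (solve-∀)
open import Data.Product using (∃-syntax; _,_; proj₂)
open import Data.Sum using (_⊎_; inj₁; inj₂)
open import Data.Vec as Vec using (Vec; []; _∷_; lookup)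
open import Data.Vec.Properties using (count≤n)
open import Data.Vec.Relation.Unary.All.Properties using (fromList⁺)
open import Defs
open import Function using (_∘_; _⇔_; mk⇔; Equivalence)
open import Relation.Binary.Definitions using (tri<; tri≈; tri>)
open import Relation.Binary.PropositionalEquality
open import Relation.Nullary using (Dec; yes; no; contradiction)
open import Relation.Nullary.Decidable using (⌊_⌋)

private
  variable
    n : ℕ

-- Polynomials with natural coefficients in the literals, as lists of gates

-- The valuation `v` is arbitrary so that the same identities serve twice: at `literalValue x` they
-- count accepting gates, at the constant 1 they count all gates.
value : (Literal n → ℕ) → List (ANDGate n) → ℕ
value v Gs = sum (map (λ G → product (map v G)) Gs)

value-++ : ∀ (v : Literal n → ℕ) Gs Hs → value v (Gs ++ Hs) ≡ value v Gs + value v Hs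
value-++ v Gs Hs = trans (cong sum (map-++ _ Gs Hs)) (sum-++ (map _ Gs) (map _ Hs))

value-map-∷ : ∀ (v : Literal n → ℕ) l Gs → value v (map (l ∷_) Gs) ≡ v l * value v Gs
value-map-∷ v l []       = sym (*-zeroʳ (v l))
value-map-∷ v l (G ∷ Gs) = begin
  v l * product (map v G) + value v (map (l ∷_) Gs)  ≡⟨ cong (v l * product (map v G) +_) (value-map-∷ v l Gs) ⟩
  v l * product (map v G) + v l * value v Gs         ≡⟨ *-distribˡ-+ (v l) _ _ ⟨
  v l * value v (G ∷ Gs)                             ∎
  where open ≡-Reasoning

scale : List (Literal n) → List (ANDGate n) → List (ANDGate n)
scale ls Gs = concatMap (λ l → map (l ∷_) Gs) ls

value-scale : ∀ (v : Literal n → ℕ) ls Gs → value v (scale ls Gs) ≡ sum (map v ls) * value v Gs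
value-scale v []       Gs = refl
value-scale v (l ∷ ls) Gs = begin
  value v (map (l ∷_) Gs ++ scale ls Gs)          ≡⟨ value-++ v (map (l ∷_) Gs) (scale ls Gs) ⟩
  value v (map (l ∷_) Gs) + value v (scale ls Gs) ≡⟨ cong₂ _+_ (value-map-∷ v l Gs) (value-scale v ls Gs) ⟩
  v l * value v Gs + sum (map v ls) * value v Gs  ≡⟨ *-distribʳ-+ (value v Gs) (v l) _ ⟨
  (v l + sum (map v ls)) * value v Gs             ∎
  where open ≡-Reasoning

scale-fanIn : ∀ {k} (ls : List (Literal n)) {Gs} →
              All (λ G → fanIn G ≤ k) Gs → All (λ G → fanIn G ≤ suc k) (scale ls Gs)
scale-fanIn []       ps = []
scale-fanIn (l ∷ ls) ps = All.++⁺ (All.map⁺ (All.map s≤s ps)) (scale-fanIn ls ps)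

copies : ℕ → List (ANDGate n) → List (ANDGate n)
copies a Gs = concat (replicate a Gs)

value-copies : ∀ (v : Literal n → ℕ) a Gs → value v (copies a Gs) ≡ a * value v Gs
value-copies v zero    Gs = refl
value-copies v (suc a) Gs = trans (value-++ v Gs (copies a Gs)) (cong (value v Gs +_) (value-copies v a Gs))

-- Copying leaves fan-ins alone; the bound is relaxed to `suc k` to match `scale-fanIn`, as the two
-- lists get concatenated.
copies-fanIn : ∀ {k} a {Gs : List (ANDGate n)} →
               All (λ G → fanIn G ≤ k) Gs → All (λ G → fanIn G ≤ suc k) (copies a Gs)
copies-fanIn a ps = All.concat⁺ (All.replicate⁺ a (All.map m≤n⇒m≤1+n ps))

product-map-1 : ∀ (G : ANDGate n) → product (map (λ _ → 1) G) ≡ 1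
product-map-1 []      = refl
product-map-1 (_ ∷ G) = trans (*-identityˡ _) (product-map-1 G)

value-1 : ∀ (Gs : List (ANDGate n)) → value (λ _ → 1) Gs ≡ length Gs
value-1 []       = refl
value-1 (G ∷ Gs) = cong₂ _+_ (product-map-1 G) (value-1 Gs)

-- Gates as monomials evaluated at an input

bit : Bool → ℕ
bit b = if b then 1 else 0

bit-∧ : ∀ b c → bit (b ∧ c) ≡ bit b * bit c
bit-∧ true  c = sym (*-identityˡ (bit c))
bit-∧ false c = refl

literalValue : Vec Bool n → Literal n → ℕ
literalValue x l = bit (evalLiteral l x)

bit-evalAND : ∀ (x : Vec Bool n) G → bit (evalAND G x) ≡ product (map (literalValue x) G)
bit-evalAND x []      = refl
bit-evalAND x (l ∷ G) =
  trans (bit-∧ (evalLiteral l x) (evalAND G x)) (cong (literalValue x l *_) (bit-evalAND x G))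

#ones-∷ : ∀ b (bs : Vec Bool n) → #ones (b ∷ bs) ≡ bit b + #ones bs
#ones-∷ true  bs = refl
#ones-∷ false bs = refl

-- An AND of bits is their product, so counting accepting gates amounts to evaluating a polynomial.
#ones-evalAND : ∀ (x : Vec Bool n) Gs →
                #ones (Vec.map (λ G → evalAND G x) (Vec.fromList Gs)) ≡ value (literalValue x) Gs
#ones-evalAND x []       = refl
#ones-evalAND x (G ∷ Gs) =
  trans (#ones-∷ (evalAND G x) (Vec.map (λ H → evalAND H x) (Vec.fromList Gs))) (cong₂ _+_ (bit-evalAND x G) (#ones-evalAND x Gs))

variables : ∀ n → List (Literal n)
variables n = List.tabulate pos

-- `v` and `h` are abstract for the sake of the induction: past the first coordinate `pos` becomes
-- `pos ∘ suc`, whose literals do not fit the shorter vector.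
sum-map-tabulate-lookup : ∀ {A : Set} (v : A → ℕ) (x : Vec Bool n) (h : Fin n → A) →
                          (∀ i → v (h i) ≡ bit (lookup x i)) → sum (map v (List.tabulate h)) ≡ #ones x
sum-map-tabulate-lookup v []      h eq = refl
sum-map-tabulate-lookup v (b ∷ x) h eq =
  trans (cong₂ _+_ (eq zero) (sum-map-tabulate-lookup v x (h ∘ suc) (eq ∘ suc))) (sym (#ones-∷ b x))

sum-variables : ∀ (x : Vec Bool n) → sum (map (literalValue x) (variables n)) ≡ #ones x
sum-variables x = sum-map-tabulate-lookup (literalValue x) x pos (λ _ → refl)

sum-1-tabulate : ∀ {A : Set} n (h : Fin n → A) → sum (map (λ _ → 1) (List.tabulate h)) ≡ n
sum-1-tabulate zero    h = refl
sum-1-tabulate (suc n) h = cong suc (sum-1-tabulate n (h ∘ suc))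

-- The expansion of ∏ (s − a) as positive − negative

-- Natural coefficients force the signs apart: (s - a)(P - N) = (sP + aN) - (sN + aP), whence the
-- mutual recursion. The empty product 1 is the single empty AND minus nothing.
positive negative : List (Fin (suc n)) → List (ANDGate n)
positive         []       = [] ∷ []
positive {n = n} (a ∷ as) = scale (variables n) (positive as) ++ copies (toℕ a) (negative as)
negative         []       = []
negative {n = n} (a ∷ as) = scale (variables n) (negative as) ++ copies (toℕ a) (positive as)

value-scale++copies : ∀ (v : Literal n → ℕ) ls Gs a Hs →
  value v (scale ls Gs ++ copies a Hs) ≡ sum (map v ls) * value v Gs + a * value v Hs
value-scale++copies v ls Gs a Hs =
  trans (value-++ v (scale ls Gs) (copies a Hs)) (cong₂ _+_ (value-scale v ls Gs) (value-copies v a Hs))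

value-scale-variables++copies : ∀ (x : Vec Bool n) Gs a Hs →
  value (literalValue x) (scale (variables n) Gs ++ copies a Hs) ≡
  #ones x * value (literalValue x) Gs + a * value (literalValue x) Hs
value-scale-variables++copies x Gs a Hs = trans
  (value-scale++copies (literalValue x) (variables _) Gs a Hs)
  (cong (λ s → s * value (literalValue x) Gs + a * value (literalValue x) Hs) (sum-variables x))

value-positive-∷ : ∀ (x : Vec Bool n) a as → value (literalValue x) (positive (a ∷ as)) ≡
  #ones x * value (literalValue x) (positive as) + toℕ a * value (literalValue x) (negative as)
value-positive-∷ x a as = value-scale-variables++copies x (positive as) (toℕ a) (negative as)

value-negative-∷ : ∀ (x : Vec Bool n) a as → value (literalValue x) (negative (a ∷ as)) ≡
  #ones x * value (literalValue x) (negative as) + toℕ a * value (literalValue x) (positive as)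
value-negative-∷ x a as = value-scale-variables++copies x (negative as) (toℕ a) (positive as)

-- The cross-multiplied form of (s − a)(p − q) = 0.
crossed-> : ∀ {s a} p q → a < s → s * p + a * q ≡ s * q + a * p → p ≡ q
crossed-> {a = a} p q a<s eq with m≤n⇒∃[o]m+o≡n a<s
-- Here s = `suc a + d`; removing `a * p + a * q` from both sides leaves `suc d * p ≡ suc d * q`.
... | d , refl = *-cancelˡ-≡ p q (suc d) (+-cancelˡ-≡ (a * p + a * q) _ _
  (trans (regroup a d p q) (trans eq (regroup′ a d p q))))
  where
  regroup : ∀ a d p q → (a * p + a * q) + suc d * p ≡ (suc a + d) * p + a * q
  regroup = solve-∀
  regroup′ : ∀ a d p q → (suc a + d) * q + a * p ≡ (a * p + a * q) + suc d * q
  regroup′ = solve-∀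

-- The integers have no zero divisors; within ℕ the sign of s - a is settled first.
crossed : ∀ s a p q → s * p + a * q ≡ s * q + a * p → s ≡ a ⊎ p ≡ q
crossed s a p q eq with <-cmp s a
... | tri≈ _ s≡a _ = inj₁ s≡a
... | tri> _ _ a<s = inj₂ (crossed-> p q a<s eq)
-- Exchanging `s` with `a` and `p` with `q` merely swaps the summands on each side.
... | tri< s<a _ _ = inj₂ (sym (crossed-> q p s<a
  (trans (+-comm (a * q) _) (trans eq (+-comm (s * q) _)))))

-- A vanishing product has a vanishing factor: `crossed` chooses between the head factor and the
-- rest. For the empty list the hypothesis is the absurd 1 ≡ 0.
vanishes⇒∈ : ∀ (x : Vec Bool n) as →
             value (literalValue x) (positive as) ≡ value (literalValue x) (negative as) → weight x ∈ as
vanishes⇒∈ x (a ∷ as) eq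
  with crossed (#ones x) (toℕ a) _ _ (trans (sym (value-positive-∷ x a as)) (trans eq (value-negative-∷ x a as)))
... | inj₁ s≡a = here (toℕ-injective (trans (toℕ-fromℕ< _) s≡a))
... | inj₂ p≡q = there (vanishes⇒∈ x as p≡q)

∈⇒vanishes : ∀ (x : Vec Bool n) {as} →
             weight x ∈ as → value (literalValue x) (positive as) ≡ value (literalValue x) (negative as)
∈⇒vanishes x {a ∷ as} w∈ =
  trans (value-positive-∷ x a as) (trans (step w∈) (sym (value-negative-∷ x a as)))
  where
  p = value (literalValue x) (positive as)
  q = value (literalValue x) (negative as)
  step : weight x ∈ a ∷ as → #ones x * p + toℕ a * q ≡ #ones x * q + toℕ a * p
  -- When a = s, both sides consist of the same two summands in opposite orders.
  step (here refl) rewrite toℕ-fromℕ< (s≤s (count≤n (_≟ true) x)) = +-comm (#ones x * p) (#ones x * q)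
  step (there w∈as) rewrite ∈⇒vanishes x w∈as = refl

positive-fanIn : ∀ (as : List (Fin (suc n))) → All (λ G → fanIn G ≤ length as) (positive as)
negative-fanIn : ∀ (as : List (Fin (suc n))) → All (λ G → fanIn G ≤ length as) (negative as)
positive-fanIn []       = z≤n ∷ []
positive-fanIn (a ∷ as) = All.++⁺ (scale-fanIn (variables _) (positive-fanIn as)) (copies-fanIn (toℕ a) (negative-fanIn as))
negative-fanIn []       = []
negative-fanIn (a ∷ as) = All.++⁺ (scale-fanIn (variables _) (negative-fanIn as)) (copies-fanIn (toℕ a) (positive-fanIn as))

length-scale++copies : ∀ (Gs : List (ANDGate n)) a Hs →
  length (scale (variables n) Gs ++ copies a Hs) ≡ n * length Gs + a * length Hs
length-scale++copies {n = n} Gs a Hs = begin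
  length (scale (variables n) Gs ++ copies a Hs)
    ≡⟨ value-1 (scale (variables n) Gs ++ copies a Hs) ⟨
  value (λ _ → 1) (scale (variables n) Gs ++ copies a Hs)
    ≡⟨ value-scale++copies (λ _ → 1) (variables n) Gs a Hs ⟩
  sum (map (λ _ → 1) (variables n)) * value (λ _ → 1) Gs + a * value (λ _ → 1) Hs
    ≡⟨ cong₂ _+_ (cong₂ _*_ (sum-1-tabulate n pos) (value-1 Gs)) (cong (a *_) (value-1 Hs)) ⟩
  n * length Gs + a * length Hs
    ∎
  where open ≡-Reasoning

-- The two lengths are bounded jointly because the cross terms recombine in their sum: a factor s -
-- a multiplies it by n + a.
length-expansion : ∀ (as : List (Fin (suc n))) →
                   length (positive as) + length (negative as) ≤ (2 * n) ^ length as
length-expansion         []       = ≤-refl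
length-expansion {n = n} (a ∷ as) = begin
  length (positive (a ∷ as)) + length (negative (a ∷ as))
    ≡⟨ cong₂ _+_ (length-scale++copies (positive as) (toℕ a) (negative as))
                 (length-scale++copies (negative as) (toℕ a) (positive as)) ⟩
  (n * p + toℕ a * q) + (n * q + toℕ a * p)
    ≡⟨ factor n (toℕ a) p q ⟩
  (n + toℕ a) * (p + q)
    -- This uses a ≤ n; `2 * n` unfolds to `n + (n + 0)`, hence `+-identityʳ`.
    ≤⟨ *-mono-≤ (+-monoʳ-≤ n (≤-trans (toℕ≤pred[n] a) (≤-reflexive (sym (+-identityʳ n))))) (length-expansion as) ⟩
  2 * n * (2 * n) ^ length as
    ∎
  where
  open ≤-Reasoning
  p = length (positive as)
  q = length (negative as)
  factor : ∀ n a p q → (n * p + a * q) + (n * q + a * p) ≡ (n + a) * (p + q)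
  factor = solve-∀

-- Complements of ANDs

negate : Literal n → Literal n
negate (pos i) = neg i
negate (neg i) = pos i

literalValue-negate : ∀ (x : Vec Bool n) l → literalValue x (negate l) + literalValue x l ≡ 1
literalValue-negate x (pos i) with lookup x i
... | true  = refl
... | false = refl
literalValue-negate x (neg i) with lookup x i
... | true  = refl
... | false = refl

-- The j-th gate tests whether the j-th literal is the first false one. So at most one gate accepts,
-- and one does exactly when the AND fails.
complement : ANDGate n → List (ANDGate n)
complement []      = []
complement (l ∷ G) = (negate l ∷ []) ∷ map (l ∷_) (complement G)

value-complement : ∀ (x : Vec Bool n) G →
                   value (literalValue x) (complement G) + product (map (literalValue x) G) ≡ 1
value-complement x []      = refl
value-complement x (l ∷ G) = begin
  (v̄ * 1 + value (literalValue x) (map (l ∷_) (complement G))) + v * g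
    ≡⟨ cong (λ m → (v̄ * 1 + m) + v * g) (value-map-∷ (literalValue x) l (complement G)) ⟩
  (v̄ * 1 + v * c) + v * g
    ≡⟨ factor v̄ v c g ⟩
  v̄ + v * (c + g)
    ≡⟨ cong (λ m → v̄ + v * m) (value-complement x G) ⟩
  v̄ + v * 1
    ≡⟨ cong (v̄ +_) (*-identityʳ v) ⟩
  v̄ + v
    ≡⟨ literalValue-negate x l ⟩
  1 ∎
  where
  open ≡-Reasoning
  v = literalValue x l
  v̄ = literalValue x (negate l)
  c = value (literalValue x) (complement G)
  g = product (map (literalValue x) G)
  factor : ∀ v̄ v c g → (v̄ * 1 + v * c) + v * g ≡ v̄ + v * (c + g)
  factor = solve-∀

value-complements : ∀ (x : Vec Bool n) Gs →
                    value (literalValue x) (concatMap complement Gs) + value (literalValue x) Gs ≡ length Gs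
value-complements x []       = refl
value-complements x (G ∷ Gs) = begin
  value v (complement G ++ concatMap complement Gs) + (g + value v Gs)
    ≡⟨ cong (_+ (g + value v Gs)) (value-++ v (complement G) _) ⟩
  (value v (complement G) + value v (concatMap complement Gs)) + (g + value v Gs)
    ≡⟨ interchange (value v (complement G)) (value v (concatMap complement Gs)) g (value v Gs) ⟩
  (value v (complement G) + g) + (value v (concatMap complement Gs) + value v Gs)
    ≡⟨ cong₂ _+_ (value-complement x G) (value-complements x Gs) ⟩
  suc (length Gs)
    ∎
  where
  open ≡-Reasoning
  v = literalValue x
  g = product (map v G)
  interchange : ∀ a b c d → (a + b) + (c + d) ≡ (a + c) + (b + d)
  interchange = solve-∀

complement-fanIn : ∀ (G : ANDGate n) → All (λ H → fanIn H ≤ fanIn G) (complement G)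
complement-fanIn []      = []
complement-fanIn (l ∷ G) = s≤s z≤n ∷ All.map⁺ (All.map s≤s (complement-fanIn G))

complements-fanIn : ∀ {k} {Gs : List (ANDGate n)} →
                    All (λ G → fanIn G ≤ k) Gs → All (λ G → fanIn G ≤ k) (concatMap complement Gs)
complements-fanIn []                = []
complements-fanIn {Gs = G ∷ _} (p ∷ ps) =
  All.++⁺ (All.map (λ q → ≤-trans q p) (complement-fanIn G)) (complements-fanIn ps)

length-complement : ∀ (G : ANDGate n) → length (complement G) ≡ fanIn G
length-complement []      = refl
length-complement (l ∷ G) = cong suc (trans (length-map (l ∷_) (complement G)) (length-complement G))

length-complements : ∀ {k} {Gs : List (ANDGate n)} →
                     All (λ G → fanIn G ≤ k) Gs → length (concatMap complement Gs) ≤ length Gs * k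
length-complements []                       = z≤n
length-complements {k = k} {Gs = G ∷ Gs} (p ∷ ps) = begin
  length (complement G ++ concatMap complement Gs)         ≡⟨ length-++ (complement G) ⟩
  length (complement G) + length (concatMap complement Gs) ≡⟨ cong (_+ _) (length-complement G) ⟩
  fanIn G + length (concatMap complement Gs)               ≤⟨ +-mono-≤ p (length-complements ps) ⟩
  k + length Gs * k                                        ∎
  where open ≤-Reasoning

-- The exact majority

gates : List (Fin (suc n)) → List (ANDGate n)
gates as = positive as ++ concatMap complement (negative as)

gates-fanIn : ∀ (as : List (Fin (suc n))) → All (λ G → fanIn G ≤ length as) (gates as)
gates-fanIn as = All.++⁺ (positive-fanIn as) (complements-fanIn (negative-fanIn as))

-- Serves to absorb the linear cost of complementing monomials into a power with exponent `k`.
1+n≤2^n : ∀ n → suc n ≤ 2 ^ n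
1+n≤2^n zero    = ≤-refl
1+n≤2^n (suc n) = begin
  1 + suc n           ≤⟨ +-mono-≤ (m^n>0 2 n) (1+n≤2^n n) ⟩
  2 ^ n + 2 ^ n       ≡⟨ cong (2 ^ n +_) (+-identityʳ (2 ^ n)) ⟨
  2 * 2 ^ n           ∎
  where open ≤-Reasoning

^-distribʳ-* : ∀ k m n → (m * n) ^ k ≡ m ^ k * n ^ k
^-distribʳ-* zero    m n = refl
^-distribʳ-* (suc k) m n =
  trans (cong (m * n *_) (^-distribʳ-* k m n)) ([m*n]*[o*p]≡[m*o]*[n*p] m n (m ^ k) (n ^ k))

length-gates : ∀ (as : List (Fin (suc n))) → length (gates as) ≤ (2 * (2 * n)) ^ length as
length-gates {n = n} as = begin
  length (gates as)                            ≡⟨ length-++ (positive as) ⟩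
  p + length (concatMap complement (negative as)) ≤⟨ +-monoʳ-≤ p (length-complements (negative-fanIn as)) ⟩
  -- A common factor lets the joint bound on `p + q` apply; it is `suc k` because `p ≤ p * k` can
  -- fail at k = 0.
  p + q * k                                    ≤⟨ +-mono-≤ (m≤m*n p (suc k)) (*-monoʳ-≤ q (n≤1+n k)) ⟩
  p * suc k + q * suc k                        ≡⟨ *-distribʳ-+ (suc k) p q ⟨
  (p + q) * suc k                              ≤⟨ *-mono-≤ (length-expansion as) (1+n≤2^n k) ⟩
  (2 * n) ^ k * 2 ^ k                          ≡⟨ *-comm ((2 * n) ^ k) (2 ^ k) ⟩
  2 ^ k * (2 * n) ^ k                          ≡⟨ ^-distribʳ-* k 2 (2 * n) ⟨
  (2 * (2 * n)) ^ k                            ∎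
  where
  open ≤-Reasoning
  k = length as
  p = length (positive as)
  q = length (negative as)

value-gates : ∀ (x : Vec Bool n) as →
  value (literalValue x) (gates as) + value (literalValue x) (negative as) ≡
  value (literalValue x) (positive as) + length (negative as)
value-gates x as = begin
  value v (gates as) + value v N                                ≡⟨ cong (_+ value v N) (value-++ v (positive as) _) ⟩
  value v (positive as) + value v (concatMap complement N) + value v N ≡⟨ +-assoc (value v (positive as)) _ _ ⟩
  value v (positive as) + (value v (concatMap complement N) + value v N) ≡⟨ cong (value v (positive as) +_) (value-complements x N) ⟩
  value v (positive as) + length N                              ∎
  where
  open ≡-Reasoning
  v = literalValue x
  N = negative as

-- The accepting gates number P + (|N| - N), which is |N| exactly when P = N. Cancelling |N| in
-- `value-gates` gives one direction, cancelling the value of N the other.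
exact⇔∈ : ∀ (x : Vec Bool n) as → value (literalValue x) (gates as) ≡ length (negative as) ⇔ weight x ∈ as
exact⇔∈ x as = mk⇔
  (λ eq → vanishes⇒∈ x as (+-cancelʳ-≡ u p q
    (trans (sym (value-gates x as)) (trans (cong (_+ q) eq) (+-comm u q)))))
  (λ w∈ → +-cancelʳ-≡ q _ u
    (trans (value-gates x as) (trans (cong (_+ u) (∈⇒vanishes x w∈)) (+-comm q u))))
  where
  u = length (negative as)
  p = value (literalValue x) (positive as)
  q = value (literalValue x) (negative as)

-- The accepted weights and the final count

support : (Fin (suc n) → Bool) → List (Fin (suc n))
support {n = n} g = filter (λ i → g i ≟ true) (allFin (suc n))

∈-support : ∀ (g : Fin (suc n) → Bool) i → i ∈ support g ⇔ g i ≡ true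
∈-support g i = mk⇔ (proj₂ ∘ ∈-filter⁻ (λ i → g i ≟ true) {xs = allFin _}) (∈-filter⁺ (λ i → g i ≟ true) (∈-allFin i))

-- Connects sparsity, counted on a vector, with the length of `support g`. The abstract `h` lets the
-- induction pass to `h ∘ suc`.
length-filter-tabulate : ∀ {A : Set} m (g : A → Bool) (h : Fin m → A) →
  length (filter (λ i → g i ≟ true) (List.tabulate h)) ≡ #ones (Vec.tabulate (g ∘ h))
length-filter-tabulate zero    g h = refl
length-filter-tabulate (suc m) g h with g (h zero)
... | true  = cong suc (length-filter-tabulate m g (h ∘ suc))
... | false = length-filter-tabulate m g (h ∘ suc)

true⇔⇒≡⌊⌋ : ∀ {A : Set} b (a? : Dec A) → A ⇔ b ≡ true → b ≡ ⌊ a? ⌋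
true⇔⇒≡⌊⌋ b     (yes a) e = Equivalence.to e a
true⇔⇒≡⌊⌋ true  (no ¬a) e = contradiction (Equivalence.from e refl) ¬a
true⇔⇒≡⌊⌋ false (no ¬a) e = refl

-- Once 2 ≤ n, 4n ≤ n³, which is where the constant 3 comes from. For k = 0 only 1 ≤ n is available,
-- but both powers are 1.
size-bound : ∀ n k → 2 * k < n → (2 * (2 * n)) ^ k ≤ n ^ (3 * k)
size-bound n zero      _    = ≤-refl
size-bound n k@(suc j) 2k<n = begin
  (2 * (2 * n)) ^ k        ≤⟨ ^-monoˡ-≤ k (*-mono-≤ 2≤n (*-mono-≤ 2≤n (≤-reflexive (sym (*-identityʳ n))))) ⟩
  (n ^ 3) ^ k              ≡⟨ ^-*-assoc n 3 k ⟩
  n ^ (3 * k)              ∎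
  where
  open ≤-Reasoning
  2≤n : 2 ≤ n
  -- Since k is a successor, 2 ≤ 2k < n.
  2≤n = ≤-trans (m≤m*n 2 k) (<⇒≤ 2k<n)

theorem5p1 : ∃[ c ] ∀ (n k : ℕ) → 2 * k < n → (f : BoolFun n) → SparseSymmetric k f → EMAJofANDs (n ^ (c * k)) k f
theorem5p1 = 3 , represent
  where
  represent : ∀ n k → 2 * k < n → (f : BoolFun n) → SparseSymmetric k f → EMAJofANDs (n ^ (3 * k)) k f
  represent n k 2k<n f ((g , f≡g) , #g≡k) =
    length (gates S) ,
    ≤-trans (subst (λ m → length (gates S) ≤ (2 * (2 * n)) ^ m) |S|≡k (length-gates S)) (size-bound n k 2k<n) ,
    Vec.fromList (gates S) ,
    fromList⁺ (subst (λ m → All (λ G → fanIn G ≤ m) (gates S)) |S|≡k (gates-fanIn S)) ,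
    length (negative S) ,
    -- Exactly |N| gates accept iff the weight of `x` lies in `S`, iff `g` is true at that weight.
    λ x → trans (f≡g x) (true⇔⇒≡⌊⌋ (g (weight x)) _ (mk⇔
      (λ eq → Equivalence.to (∈-support g (weight x))
        (Equivalence.to (exact⇔∈ x S) (trans (sym (#ones-evalAND x (gates S))) eq)))
      (λ gw → trans (#ones-evalAND x (gates S))
        (Equivalence.from (exact⇔∈ x S) (Equivalence.from (∈-support g (weight x)) gw)))))
    where
    S = support g
    |S|≡k : length S ≡ k
    |S|≡k = trans (length-filter-tabulate (suc n) g (λ i → i)) #g≡k
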